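{- Let $\mathbf{X}$ be a star decomposable simplicial complex, let $W\subseteq V(\mathbf{X})$ be a set which induces a star partition of $\mathbf{X}$, and let $\prec$ be a total order on $W$ which induces a star decomposition of $\mathbf{X}$. Let $\prec'$ be the partial order on $V(\mathbf{X})$ derived from $\prec$. Then $\mathbf{X}$ is vertex decomposable in a shedding order extending $\prec'$ (that is, there is a total order on $V(\mathbf{X})$ which extends $\prec'$ and is a shedding order of $\mathbf{X}$).
   Context: Simplicial complexes are finite abstract simplicial complexes; the void complex $\emptyset$ is distinguished from $\{\emptyset\}$ (dimension $-1$). $V(\mathbf{X})$ is the vertex set; pure means all inclusion-wise maximal faces have equal dimension. For a vertex $v$: $\mathrm{lk}(v,\mathbf{X})=\{\sigma\setminus\{v\}: v\in\sigma\in\mathbf{X}\}$, $\mathrm{st}(v,\mathbf{X})=\{\sigma\in\mathbf{X}:\sigma\cup\{v\}\in\mathbf{X}\}$, and $\mathrm{st}(W',\mathbf{X})=\bigcup_{w\in W'}\mathrm{st}(w,\mathbf{X})$ for $W'\subseteq V(\mathbf{X})$. $\mathbf{X}-v$ is the complex of faces not containing $v$. Star partition: $W\subseteq V(\mathbf{X})$ induces a star partition of $\mathbf{X}$ if $\mathbf{X}=\mathrm{st}(W,\mathbf{X})$ and no two distinct vertices of $W$ are joined by an edge of $\mathbf{X}$. For a total order $\prec$ on $W$ put $W_{\succ w}=\{w'\in W:w'\succ w\}$, $W_{\succeq w}=\{w'\in W: w'\succeq w\}$. For $x\in W$, $W'\subseteq W$, the overlap is $\mathbf{O}(x,W')=\mathrm{lk}(x,\mathbf{X})\cap\mathrm{st}(W',\mathbf{X})$.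 Star decomposability is defined by induction on $k$ for pairs $(\mathbf{X},X)$ with $\mathbf{X}$ pure $k$-dimensional, $k\ge -1$, $X\subseteq V(\mathbf{X})$; $\mathbf{X}$ is star decomposable if $(\mathbf{X},X)$ is star decomposable for some $X\subseteq V(\mathbf{X})$. For $k=-1$, $(\{\emptyset\},\emptyset)$ is star decomposable (and for $\mathbf X=\{\emptyset\}$ we let $W=\emptyset$ with the empty order count as inducing a star partition and a star decomposition). For $k\ge 0$, $(\mathbf{X},X)$ is star decomposable if there is a nonempty $W\subseteq V(\mathbf{X})$ inducing a star partition of $\mathbf{X}$ and a total order $\prec$ on $W$ such that: (Order condition) $X=W_{\succeq w'}$ for some $w'\in W$; (Link condition) for every $w\in W$ other than the last vertex of $\prec$, there is a nonempty set $U\subseteq V(\mathrm{lk}(w,\mathbf{X}))$ such that $\mathrm{st}(U,\mathrm{lk}(w,\mathbf{X}))=\mathbf{O}(w,W_{\succ w})$ and the pair $(\mathrm{lk}(w,\mathbf{X}),U)$ is star decomposable; when $k=0$ this condition is regarded as automatically satisfied; (Last vertex condition) for the last vertex $\hat w$ of $\prec$, $\mathrm{lk}(\hat w,\mathbf{X})$ is star decomposable. An order $\prec$ on $W$ satisfying these conditions is said to induce a star decomposition of $(\mathbf{X},X)$; it induces a star decomposition of $\mathbf{X}$ if it does so for $(\mathbf X,X)$ for some $X$. Derived order: for $v\in V(\mathbf{X})$ let $p(v)$ be the $\prec$-last vertex $w\in W$ with $v\in\mathrm{st}(w,\mathbf{X})$ (so $p(w)=w$ for $w\in W$). The partial order $\prec'$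 on $V(\mathbf{X})$ derived from $\prec$ is: $v\prec' v'$ if $p(v)\prec p(v')$; $v\prec' w$ if $w\in W$, $p(v)=w$ and $v\ne w$; distinct $v,v'\notin W$ with $p(v)=p(v')$ are incomparable. Vertex decomposability: a $d$-dimensional complex $\mathbf{K}$ is vertex decomposable if it is pure and either it is a $d$-simplex (for $d=-1$ this is $\{\emptyset\}$), or there is a vertex $v$ such that $\mathbf{K}-v$ is $d$-dimensional vertex decomposable and $\mathrm{lk}(v,\mathbf{K})$ is $(d-1)$-dimensional vertex decomposable. A total order $v_1,\dots,v_n$ of $V(\mathbf{K})$ is a shedding order of a pure $d$-complex $\mathbf{K}$ if, with $\mathbf{K}_0=\mathbf{K}$ and $\mathbf{K}_i=\mathbf{K}_{i-1}-v_i$, for each $1\le i\le n-(d+1)$ the link $\mathrm{lk}(v_i,\mathbf{K}_{i-1})$ is $(d-1)$-dimensional vertex decomposable and $\mathbf{K}_i$ is $d$-dimensional vertex decomposable, and $\mathbf{K}_{n-(d+1)}$ is a $d$-simplex (the last $d+1$ vertices may come in any order). -}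

module Defs where

import Data.Bool.Properties as Bool
open import Data.Fin.Base as Fin using (Fin; toℕ)
open import Data.Fin.Subset
open import Data.Fin.Subset.Properties
open import Data.List.Base using (List; length; lookup; take; foldl)
open import Data.List.Membership.Propositional using () renaming (_∈_ to _∈ₗ_)
open import Data.List.Relation.Unary.Unique.Propositional using (Unique)
open import Data.Nat.Base using (ℕ; zero; suc; pred; _≤_; _<_; _∸_)
open import Data.Product using (∃; ∃₂; ∃-syntax; _×_; _,_; proj₁)
open import Data.Sum using (_⊎_; inj₁; inj₂)
open import Data.Vec.Base using (_∷_; here; there)
open import Data.Vec.Properties using (≡-dec)
open import Function using (_on_; flip; _⇔_)
open import Level using (0ℓ)
open import Relation.Binary using (Rel; IsStrictTotalOrder)
open import Relation.Binary.PropositionalEquality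
open import Relation.Nullary
open import Relation.Unary using (Pred; Decidable; _≐_; ｛_｝) renaming (_∩_ to _∩ᵖ_)

private
  variable
    n : ℕ

-- The ground set Fin n may contain elements that are not vertices, so links
-- and deletions live over the same ground set.  The void complex (no faces)
-- is allowed and differs from the complex whose only face is ⊥.

record Complex (n : ℕ) : Set₁ where
  field
    Face   : Pred (Subset n) 0ℓ
    Face?  : Decidable Face
    closed : ∀ {σ τ} → σ ⊆ τ → Face τ → Face σ

open Complex public

Vertex : Complex n → Pred (Fin n) 0ℓ
Vertex X v = Face X ⁅ v ⁆

Facet : Complex n → Pred (Subset n) 0ℓ
Facet X σ = Face X σ × (∀ τ → Face X τ → σ ⊆ τ → τ ≡ σ)

Pure : Complex n → Set
Pure X = ∀ σ τ → Facet X σ → Facet X τ → ∣ σ ∣ ≡ ∣ τ ∣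

-- Dimensions start at -1, so they are recorded throughout as the natural
-- number r = dimension + 1, the number of vertices of a face of top dimension.

HasRank : ℕ → Complex n → Set
HasRank r X = (∃[ σ ] Face X σ × ∣ σ ∣ ≡ r) × (∀ σ → Face X σ → ∣ σ ∣ ≤ r)

PureOfRank : ℕ → Complex n → Set
PureOfRank r X = Pure X × HasRank r X

IsSimplex : ℕ → Complex n → Set
IsSimplex r X = ∃[ σ ] ∣ σ ∣ ≡ r × Face X ≐ (_⊆ σ)

private
  ∪-⊆ : {p q r : Subset n} → p ⊆ r → q ⊆ r → p ∪ q ⊆ r
  ∪-⊆ {p = p} {q} p⊆r q⊆r x∈ with x∈p∪q⁻ p q x∈
  ... | inj₁ x∈p = p⊆r x∈p
  ... | inj₂ x∈q = q⊆r x∈q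

  ⁅⁆⊆ : {v : Fin n} {p : Subset n} → v ∈ p → ⁅ v ⁆ ⊆ p
  ⁅⁆⊆ {p = p} v∈p x∈ = subst (_∈ p) (sym (x∈⁅y⁆⇒x≡y _ x∈)) v∈p

  ∈─⇒∉ : {v : Fin n} (p q : Subset n) → v ∈ p ─ q → v ∉ q
  ∈─⇒∉ (_ ∷ p) (_ ∷ q) (there v∈) (there v∈q) = ∈─⇒∉ p q v∈ v∈q
  ∈─⇒∉ (_ ∷ p) (_ ∷ q) () here

  ∉-removed : (p : Subset n) (v : Fin n) → v ∉ p - v
  ∉-removed p v v∈ = ∈─⇒∉ p ⁅ v ⁆ v∈ (x∈⁅x⁆ v)

  remove-added : (p : Subset n) (v : Fin n) → v ∉ p → p ≡ (p ∪ ⁅ v ⁆) - v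
  remove-added p v v∉p = ⊆-antisym
    (λ x∈p → x∈p∧x≢y⇒x∈p-y (p⊆p∪q ⁅ v ⁆ x∈p) λ { refl → v∉p x∈p })
    back
    where
    back : (p ∪ ⁅ v ⁆) - v ⊆ p
    back {x} x∈ with x∈p∪q⁻ p ⁅ v ⁆ (p─q⊆p (p ∪ ⁅ v ⁆) ⁅ v ⁆ x∈)
    ... | inj₁ x∈p = x∈p
    ... | inj₂ x∈v with refl ← x∈⁅y⁆⇒x≡y v x∈v = contradiction x∈ (∉-removed (p ∪ ⁅ v ⁆) v)

lk : Fin n → Complex n → Complex n
lk {n} v X = record { Face = LkFace ; Face? = dec ; closed = down }
  where
  LkFace : Pred (Subset n) 0ℓ
  LkFace σ = ∃[ τ ] v ∈ τ × Face X τ × σ ≡ τ - v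

  dec : Decidable LkFace
  dec σ = anySubset? λ τ → (v ∈? τ) ×-dec Face? X τ ×-dec ≡-dec Bool._≟_ σ (τ - v)

  down : ∀ {σ τ} → σ ⊆ τ → LkFace τ → LkFace σ
  down {σ} σ⊆ (ρ , v∈ρ , ρ∈X , refl) =
    σ ∪ ⁅ v ⁆ , q⊆p∪q σ ⁅ v ⁆ (x∈⁅x⁆ v)
      , closed X (∪-⊆ (λ x∈σ → p─q⊆p ρ ⁅ v ⁆ (σ⊆ x∈σ)) (⁅⁆⊆ v∈ρ)) ρ∈X
      , remove-added σ v (λ v∈σ → ∉-removed ρ v (σ⊆ v∈σ))

delete : Fin n → Complex n → Complex n
delete v X = record
  { Face   = λ σ → Face X σ × v ∉ σ
  ; Face?  = λ σ → Face? X σ ×-dec ¬? (v ∈? σ)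
  ; closed = λ σ⊆τ (τ∈X , v∉τ) → closed X σ⊆τ τ∈X , λ v∈σ → v∉τ (σ⊆τ v∈σ)
  }

-- The star of a set of vertices and the overlap only enter through equalities
-- of sets of faces, so they are kept as predicates on faces.

st : Fin n → Complex n → Pred (Subset n) 0ℓ
st v X σ = Face X σ × Face X (σ ∪ ⁅ v ⁆)

stₛ : Pred (Fin n) 0ℓ → Complex n → Pred (Subset n) 0ℓ
stₛ W X σ = ∃[ w ] W w × st w X σ

O : Fin n → Pred (Fin n) 0ℓ → Complex n → Pred (Subset n) 0ℓ
O x W X = Face (lk x X) ∩ᵖ stₛ W X

-- The first alternative is a convention: the empty set of vertices induces a
-- star partition of the complex {∅}, although its star is void.

InducesStarPartition : Complex n → Subset n → Set
InducesStarPartition X W =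
  (Face X ≐ ｛ ⊥ ｝ × W ≡ ⊥)
  ⊎ ((∀ {w} → w ∈ W → Vertex X w)
     × Face X ≐ stₛ (_∈ W) X
     × (∀ {w w′} → w ∈ W → w′ ∈ W → w ≢ w′ → ¬ Face X (⁅ w ⁆ ∪ ⁅ w′ ⁆)))

-- Only the restriction of _≺_ to W is constrained, and only it is ever used.

IsTotalOrderOn : Subset n → Rel (Fin n) 0ℓ → Set
IsTotalOrderOn W _≺_ =
  IsStrictTotalOrder {A = ∃ (_∈ W)} (_≡_ on proj₁) (_≺_ on proj₁)

_⟨_⟩≻_ : Subset n → Rel (Fin n) 0ℓ → Fin n → Pred (Fin n) 0ℓ
(W ⟨ _≺_ ⟩≻ w) w′ = w′ ∈ W × w ≺ w′

_⟨_⟩⪰_ : Subset n → Rel (Fin n) 0ℓ → Fin n → Pred (Fin n) 0ℓ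
(W ⟨ _≺_ ⟩⪰ w) w′ = w′ ∈ W × (w ≺ w′ ⊎ w ≡ w′)

IsLast : Pred (Fin n) 0ℓ → Rel (Fin n) 0ℓ → Pred (Fin n) 0ℓ
IsLast P _≺_ w = P w × (∀ {w′} → P w′ → w′ ≺ w ⊎ w′ ≡ w)

-- The conditions on a complex of dimension k ≥ 0; SD is star decomposability
-- of pairs in dimension k - 1.

record StarDecompositionConditions
  (k : ℕ) (SD : Complex n → Subset n → Set₁)
  (X : Complex n) (S W : Subset n) (_≺_ : Rel (Fin n) 0ℓ) : Set₁ where
  field
    nonempty : Nonempty W
    order    : ∃[ w ] w ∈ W × (_∈ S) ≐ (W ⟨ _≺_ ⟩⪰ w)
    link     : 0 < k → ∀ {w} → w ∈ W → ¬ IsLast (_∈ W) _≺_ w →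
               ∃[ U ] Nonempty U
                 × (∀ {u} → u ∈ U → Vertex (lk w X) u)
                 × stₛ (_∈ U) (lk w X) ≐ O w (W ⟨ _≺_ ⟩≻ w) X
                 × SD (lk w X) U
    last     : ∀ {w} → IsLast (_∈ W) _≺_ w → ∃[ U ] SD (lk w X) U

data InducesStarDecompositionOfPair {n} :
  ℕ → Complex n → Subset n → Subset n → Rel (Fin n) 0ℓ → Set₁

data StarDecomposablePair {n} : ℕ → Complex n → Subset n → Set₁ where
  base : ∀ {X S} → Face X ≐ ｛ ⊥ ｝ → S ≡ ⊥ → StarDecomposablePair 0 X S
  step : ∀ {k X S W _≺_} → PureOfRank (suc k) X →
         InducesStarPartition X W → IsTotalOrderOn W _≺_ →
         InducesStarDecompositionOfPair (suc k) X S W _≺_ →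
         StarDecomposablePair (suc k) X S

data InducesStarDecompositionOfPair {n} where
  base : ∀ {X S W _≺_} → Face X ≐ ｛ ⊥ ｝ → S ≡ ⊥ → W ≡ ⊥ →
         InducesStarDecompositionOfPair 0 X S W _≺_
  step : ∀ {k X S W _≺_} →
         StarDecompositionConditions k (StarDecomposablePair k) X S W _≺_ →
         InducesStarDecompositionOfPair (suc k) X S W _≺_

StarDecomposable : ℕ → Complex n → Set₁
StarDecomposable r X = ∃[ S ] StarDecomposablePair r X S

InducesStarDecomposition : ℕ → Complex n → Subset n → Rel (Fin n) 0ℓ → Set₁
InducesStarDecomposition r X W _≺_ =
  ∃[ S ] InducesStarDecompositionOfPair r X S W _≺_

-- p(v) as a functional relation: w is the last vertex of W whose star
-- contains v.

IsP : Complex n → Subset n → Rel (Fin n) 0ℓ → Fin n → Fin n → Set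
IsP X W _≺_ v w = IsLast (λ w′ → w′ ∈ W × st w′ X ⁅ v ⁆) _≺_ w

DerivedOrder : Complex n → Subset n → Rel (Fin n) 0ℓ → Rel (Fin n) 0ℓ
DerivedOrder X W _≺_ v v′ =
  (∃₂ λ w w′ → IsP X W _≺_ v w × IsP X W _≺_ v′ w′ × w ≺ w′)
  ⊎ (v′ ∈ W × IsP X W _≺_ v v′ × v ≢ v′)

data VertexDecomposable {n} : ℕ → Complex n → Set₁ where
  simplex : ∀ {r K} → PureOfRank r K → IsSimplex r K → VertexDecomposable r K
  shed    : ∀ {r K} → PureOfRank (suc r) K → ∀ v → Vertex K v →
            VertexDecomposable (suc r) (delete v K) →
            VertexDecomposable r (lk v K) →
            VertexDecomposable (suc r) K

-- A total order on the vertices is a duplicate-free list of them.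

Enumerates : List (Fin n) → Pred (Fin n) 0ℓ → Set
Enumerates vs P = Unique vs × (∀ v → v ∈ₗ vs ⇔ P v)

Precedes : List (Fin n) → Rel (Fin n) 0ℓ
Precedes vs v v′ =
  ∃₂ λ i j → i Fin.< j × lookup vs i ≡ v × lookup vs j ≡ v′

deleteFirst : ℕ → List (Fin n) → Complex n → Complex n
deleteFirst i vs K = foldl (flip delete) K (take i vs)

-- The index i is 0-based: lookup vs i is the vertex removed from
-- deleteFirst (toℕ i) vs K.  If r = 0, there are no vertices, so `pred r` is
-- only used for r > 0.

record IsSheddingOrder (r : ℕ) (K : Complex n) (vs : List (Fin n)) : Set₁ where
  field
    pure       : PureOfRank r K
    enumerates : Enumerates vs (Vertex K)
    links      : ∀ (i : Fin (length vs)) → toℕ i < length vs ∸ r →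
                 VertexDecomposable (pred r) (lk (lookup vs i) (deleteFirst (toℕ i) vs K))
    deletions  : ∀ (i : Fin (length vs)) → toℕ i < length vs ∸ r →
                 VertexDecomposable r (deleteFirst (suc (toℕ i)) vs K)
    remainder  : IsSimplex r (deleteFirst (length vs ∸ r) vs K)

{-# OPTIONS --safe #-}
-- The vertices are shed in blocks, one for each w in W, in the order ≺: first the vertices
-- whose last star is that of w, then w.  When the block of w begins, X has been cut down to
-- M ∪ (w * L), where M is the star of the later vertices and L = lk w.  The vertices of the block
-- are exactly those of L outside M, so their links are cones with apex w over links in L.  The
-- link condition says that L ∩ M is the star of a final segment U of a star decomposition of L;
-- by induction on the dimension L can be shed down to st(U, L) = L ∩ M.  After that the
-- link of w is L ∩ M, and deleting w leaves M.  For the last w what remains is the cone w * L.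

module Submission where

open import Defs
open import Data.Bool.Base using (true; false)
open import Data.Fin.Base as Fin using (Fin; zero; suc; toℕ)
import Data.Fin.Properties as Fin
open import Data.Fin.Subset
open import Data.Fin.Subset.Properties
open import Data.List.Base using (List; []; _∷_; _++_; foldl; filter; length; allFin; lookup)
open import Data.List.Properties using (foldl-++)
open import Data.List.Membership.Propositional using () renaming (_∈_ to _∈ₗ_)
open import Data.List.Membership.Propositional.Properties
  using (∈-++⁻; ∈-++⁺ˡ; ∈-++⁺ʳ; ∈-filter⁺; ∈-filter⁻; ∈-allFin)
open import Data.List.Relation.Unary.All as All using (All; []; _∷_)
open import Data.List.Relation.Unary.AllPairs as AllPairs using (AllPairs; []; _∷_)
open import Data.List.Relation.Unary.Any using (here; there; index)
open import Data.List.Relation.Unary.Any.Properties using (lookup-index)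
open import Data.List.Relation.Unary.Unique.Propositional.Properties using (allFin⁺; filter⁺; ++⁺)
open import Data.Nat.Base using (ℕ; zero; suc; pred; _≤_; _<_; _∸_; z≤n; s≤s)
open import Data.Nat.Properties
  using (≤-trans; ≤-reflexive; n≤1+n; n≤0⇒n≡0; n∸n≡0; +-∸-assoc)
open import Data.Product using (∃-syntax; _×_; _,_; proj₁; proj₂)
open import Data.Sum using (_⊎_; inj₁; inj₂; [_,_]′)
import Data.Vec.Base as Vec
open import Function using (_⇔_; Equivalence; mk⇔; flip; _∘_)
open import Level using (0ℓ)
open import Relation.Binary using (Rel; IsStrictTotalOrder; tri<; tri≈; tri>)
open import Relation.Binary.PropositionalEquality
open import Relation.Nullary
open import Relation.Unary using (Pred; _≐_; ｛_｝; ∅)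
open import Relation.Unary.Properties using (≐-sym; ≐-trans)

private
  variable
    n k r : ℕ
    u v w : Fin n
    σ τ ρ : Subset n
    us vs ws : List (Fin n)
    K L X : Complex n
    W : Subset n

-- Adding an element to a finite set and removing one.

v∈σ∪⁅v⁆ : (σ : Subset n) → v ∈ σ ∪ ⁅ v ⁆
v∈σ∪⁅v⁆ σ = q⊆p∪q σ _ (x∈⁅x⁆ _)

x∈σ∪⁅v⁆⁻ : (σ : Subset n) → u ∈ σ ∪ ⁅ v ⁆ → u ∈ σ ⊎ u ≡ v
x∈σ∪⁅v⁆⁻ σ u∈ with x∈p∪q⁻ σ _ u∈
... | inj₁ u∈σ = inj₁ u∈σ
... | inj₂ u∈v = inj₂ (x∈⁅y⁆⇒x≡y _ u∈v)

v∉σ-v : (σ : Subset n) (v : Fin n) → v ∉ σ - v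
-- Removing `v` a second time changes nothing, whereas removing a member gives a strictly smaller
-- set.
v∉σ-v σ v v∈ = ⊂-irref (p─q─q≡p─q σ ⁅ v ⁆) (x∈p⇒p-x⊂p v∈)

x∈σ-v⁻ : (σ : Subset n) → u ∈ σ - v → u ∈ σ × u ≢ v
x∈σ-v⁻ σ u∈ = p─q⊆p σ _ u∈ , λ { refl → v∉σ-v σ _ u∈ }

∪⁅⁆-⊆ : σ ⊆ τ → v ∈ τ → σ ∪ ⁅ v ⁆ ⊆ τ
∪⁅⁆-⊆ {σ = σ} σ⊆ v∈ x∈ with x∈σ∪⁅v⁆⁻ σ x∈
... | inj₁ x∈σ = σ⊆ x∈σ
... | inj₂ refl = v∈

⁅⁆-⊆ : v ∈ σ → ⁅ v ⁆ ⊆ σ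
⁅⁆-⊆ v∈ x∈ with refl ← x∈⁅y⁆⇒x≡y _ x∈ = v∈

∪⁅⁆-mono : σ ⊆ τ → σ ∪ ⁅ v ⁆ ⊆ τ ∪ ⁅ v ⁆
∪⁅⁆-mono {τ = τ} σ⊆ = ∪⁅⁆-⊆ (p⊆p∪q _ ∘ σ⊆) (v∈σ∪⁅v⁆ τ)

[σ-v]∪⁅v⁆⊆σ : v ∈ σ → (σ - v) ∪ ⁅ v ⁆ ⊆ σ
[σ-v]∪⁅v⁆⊆σ {σ = σ} = ∪⁅⁆-⊆ (p─q⊆p σ _)

σ⊆[σ-v]∪⁅v⁆ : (σ : Subset n) (v : Fin n) → σ ⊆ (σ - v) ∪ ⁅ v ⁆
σ⊆[σ-v]∪⁅v⁆ σ v {x} x∈ with x Fin.≟ v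
... | yes refl = v∈σ∪⁅v⁆ (σ - v)
... | no x≢v = p⊆p∪q _ (x∈p∧x≢y⇒x∈p-y x∈ x≢v)

[σ∪⁅v⁆]-v⊆σ : (σ : Subset n) → (σ ∪ ⁅ v ⁆) - v ⊆ σ
[σ∪⁅v⁆]-v⊆σ {v = v} σ x∈ with x∈σ-v⁻ (σ ∪ ⁅ v ⁆) x∈
... | x∈σv , x≢v with x∈σ∪⁅v⁆⁻ σ x∈σv
... | inj₁ x∈σ = x∈σ
... | inj₂ x≡v = contradiction x≡v x≢v

-⊇ : v ∉ σ → σ ⊆ τ → σ ⊆ τ - v
-⊇ v∉ σ⊆ x∈ = x∈p∧x≢y⇒x∈p-y (σ⊆ x∈) λ { refl → v∉ x∈ }

[σ∪⁅v⁆]-v≡σ : v ∉ σ → (σ ∪ ⁅ v ⁆) - v ≡ σ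
[σ∪⁅v⁆]-v≡σ {σ = σ} v∉ = ⊆-antisym ([σ∪⁅v⁆]-v⊆σ σ) (-⊇ v∉ (p⊆p∪q _))

∣σ∣≡1+∣σ-v∣ : v ∈ σ → ∣ σ ∣ ≡ suc ∣ σ - v ∣
∣σ∣≡1+∣σ-v∣ {σ = _ Vec.∷ σ} Vec.here = cong (suc ∘ ∣_∣) (sym (p─⊥≡p σ))
∣σ∣≡1+∣σ-v∣ {σ = true Vec.∷ σ} (Vec.there v∈) = cong suc (∣σ∣≡1+∣σ-v∣ v∈)
∣σ∣≡1+∣σ-v∣ {σ = false Vec.∷ σ} (Vec.there v∈) = ∣σ∣≡1+∣σ-v∣ v∈

∣σ∪⁅v⁆∣≡1+∣σ∣ : v ∉ σ → ∣ σ ∪ ⁅ v ⁆ ∣ ≡ suc ∣ σ ∣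
∣σ∪⁅v⁆∣≡1+∣σ∣ {σ = σ} v∉ = trans (∣σ∣≡1+∣σ-v∣ (v∈σ∪⁅v⁆ σ))
  (cong (suc ∘ ∣_∣) ([σ∪⁅v⁆]-v≡σ v∉))

∣σ∣≤0⇒σ≡⊥ : ∣ σ ∣ ≤ 0 → σ ≡ ⊥
∣σ∣≤0⇒σ≡⊥ {σ = σ} ∣σ∣≤0 = Empty-unique λ (x , x∈) →
  contradiction (trans (sym (∣σ∣≡1+∣σ-v∣ x∈)) (n≤0⇒n≡0 ∣σ∣≤0)) λ ()

-- Faces of links and deletions.

-- With `Face-lk⁺` this replaces the existential form of the link by the usual one: sets that avoid
-- `v` and stay faces when `v` is added.
Face-lk⁻ : (X : Complex n) → Face (lk v X) σ → v ∉ σ × Face X (σ ∪ ⁅ v ⁆)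
Face-lk⁻ X (τ , v∈τ , τ∈X , refl) = v∉σ-v τ _ , closed X ([σ-v]∪⁅v⁆⊆σ v∈τ) τ∈X

Face-lk⁺ : (X : Complex n) → v ∉ σ → Face X (σ ∪ ⁅ v ⁆) → Face (lk v X) σ
Face-lk⁺ {v = v} {σ} X v∉σ σv∈X =
  σ ∪ ⁅ v ⁆ , v∈σ∪⁅v⁆ σ , σv∈X , sym ([σ∪⁅v⁆]-v≡σ v∉σ)

lk-cong : (K L : Complex n) → Face K ≐ Face L → Face (lk v K) ≐ Face (lk v L)
lk-cong K L (to , from) =
  (λ (τ , v∈ , τ∈ , eq) → τ , v∈ , to τ∈ , eq) , (λ (τ , v∈ , τ∈ , eq) → τ , v∈ , from τ∈ , eq)

delete-cong : (K L : Complex n) → Face K ≐ Face L → Face (delete v K) ≐ Face (delete v L)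
delete-cong K L (to , from) = (λ (σ∈ , v∉) → to σ∈ , v∉) , (λ (σ∈ , v∉) → from σ∈ , v∉)

lk⊆ : (X : Complex n) → Face (lk v X) σ → Face X σ
lk⊆ X σ∈ = closed X (p⊆p∪q _) (proj₂ (Face-lk⁻ X σ∈))

-- Purity and vertex decomposability.

-- Equivalent to PureOfRank, but stable under gluing a link and a deletion
-- without having to extend faces to facets.
record Ranked (r : ℕ) (K : Complex n) : Set where
  field
    ⊥∈     : Face K ⊥
    bound  : Face K σ → ∣ σ ∣ ≤ r
    extend : Face K σ → ∃[ τ ] Face K τ × σ ⊆ τ × ∣ τ ∣ ≡ r

open Ranked

Ranked⇒PureOfRank : Ranked r K → PureOfRank r K
Ranked⇒PureOfRank {r = r} {K = K} R =
  (λ σ τ σ-facet τ-facet → trans (card σ-facet) (sym (card τ-facet)))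
  , (let τ , τ∈ , _ , ∣τ∣ = extend R (⊥∈ R) in τ , τ∈ , ∣τ∣) , λ _ → bound R
  where
  card : Facet K σ → ∣ σ ∣ ≡ r
  card (σ∈ , maximal) with τ , τ∈ , σ⊆τ , ∣τ∣ ← extend R σ∈ =
    subst (λ ρ → ∣ ρ ∣ ≡ r) (maximal τ τ∈ σ⊆τ) ∣τ∣

Ranked-simplex : IsSimplex r K → Ranked r K
Ranked-simplex (σ , refl , to , from) = record
  { ⊥∈     = from (⊆-min _)
  ; bound  = λ τ∈ → p⊆q⇒∣p∣≤∣q∣ (to τ∈)
  ; extend = λ τ∈ → σ , from ⊆-refl , to τ∈ , refl
  }

-- Faces through `v` are bounded and extended in the link, all others in the deletion.
Ranked-glue : ∀ v → Ranked (suc r) (delete v K) → Ranked r (lk v K) → Ranked (suc r) K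
Ranked-glue {r = r} {K = K} v D R = record { ⊥∈ = proj₁ (⊥∈ D) ; bound = bd ; extend = ext }
  where
  σ-v∈lk : v ∈ σ → Face K σ → Face (lk v K) (σ - v)
  σ-v∈lk {σ} v∈ σ∈ = Face-lk⁺ K (v∉σ-v σ v) (closed K ([σ-v]∪⁅v⁆⊆σ v∈) σ∈)

  bd : Face K σ → ∣ σ ∣ ≤ suc r
  bd {σ} σ∈ with v ∈? σ
  ... | yes v∈ = ≤-trans (≤-reflexive (∣σ∣≡1+∣σ-v∣ v∈)) (s≤s (bound R (σ-v∈lk v∈ σ∈)))
  ... | no v∉ = bound D (σ∈ , v∉)

  ext : Face K σ → ∃[ τ ] Face K τ × σ ⊆ τ × ∣ τ ∣ ≡ suc r
  ext {σ} σ∈ with v ∈? σ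
  ... | no v∉ with τ , (τ∈ , _) , σ⊆τ , ∣τ∣ ← extend D (σ∈ , v∉) = τ , τ∈ , σ⊆τ , ∣τ∣
  ... | yes v∈ with τ , τ∈ , σ⊆τ , ∣τ∣ ← extend R (σ-v∈lk v∈ σ∈) =
    let v∉τ , τv∈ = Face-lk⁻ K τ∈ in
    τ ∪ ⁅ v ⁆ , τv∈ , ∪⁅⁆-mono σ⊆τ ∘ σ⊆[σ-v]∪⁅v⁆ σ v
      , trans (∣σ∪⁅v⁆∣≡1+∣σ∣ v∉τ) (cong suc ∣τ∣)

VD-ranked : VertexDecomposable r K → Ranked r K
VD-ranked {K = K} (simplex _ s) = Ranked-simplex {K = K} s
VD-ranked (shed _ v _ D R) = Ranked-glue v (VD-ranked D) (VD-ranked R)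

VD-simplex : IsSimplex r K → VertexDecomposable r K
VD-simplex {K = K} s = simplex (Ranked⇒PureOfRank (Ranked-simplex {K = K} s)) s

-- Purity is read off from the link and the deletion through `Ranked`, so a decomposition can be
-- rebuilt without a separate proof of it.
VD-shed : Vertex K v → VertexDecomposable r (lk v K) →
          VertexDecomposable (suc r) (delete v K) → VertexDecomposable (suc r) K
VD-shed v∈ R D = shed (Ranked⇒PureOfRank (Ranked-glue _ (VD-ranked D) (VD-ranked R))) _ v∈ D R

-- Complexes with the same faces need not be equal as records, so the decomposition is rebuilt step
-- by step.
VD-resp-≐ : (K L : Complex n) → Face K ≐ Face L → VertexDecomposable r K → VertexDecomposable r L
VD-resp-≐ K L K≐L (simplex _ (σ , ∣σ∣ , eq)) = VD-simplex (σ , ∣σ∣ , ≐-trans (≐-sym K≐L) eq)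
VD-resp-≐ K L K≐L (shed _ v v∈ D R) = VD-shed (proj₁ K≐L v∈)
  (VD-resp-≐ (lk v K) (lk v L) (lk-cong K L K≐L) R)
  (VD-resp-≐ (delete v K) (delete v L) (delete-cong K L K≐L) D)

-- Gluing a cone to a subcomplex.

-- K is the union of the subcomplex M, which avoids w, and the cone over L with apex w.
record Glue (w : Fin n) (M : Pred (Subset n) 0ℓ) (L K : Complex n) : Set where
  field
    M-closed : σ ⊆ τ → M τ → M σ
    w∉M      : M σ → w ∉ σ
    w∉L      : Face L σ → w ∉ σ
    faces    : Face K ≐ (λ σ → M σ ⊎ Face L (σ - w))

open Glue

Cone : Fin n → Complex n → Complex n → Set
Cone w = Glue w ∅

module _ {M : Pred (Subset n) 0ℓ} (G : Glue w M L K) where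

  glue-vertex : Vertex L v → Vertex K v
  glue-vertex v∈L = proj₂ (faces G) (inj₂ (closed L (p─q⊆p _ _) v∈L))

  glue-≢ : Vertex L v → v ≢ w
  glue-≢ v∈L refl = w∉L G v∈L (x∈⁅x⁆ _)

  -- No face of `M` contains `v`, so the link of `v` sees only the cone, and a link in a cone is the
  -- cone over the link in the base.
  glue-lk : v ≢ w → ¬ M ⁅ v ⁆ → Cone w (lk v L) (lk v K)
  glue-lk {v} v≢w v∉M = record
    { M-closed = λ _ ()
    ; w∉M = λ ()
    ; w∉L = w∉L G ∘ lk⊆ L
    ; faces = to , λ { (inj₂ σ∈) → from σ∈ }
    }
    where
    to : Face (lk v K) σ → ∅ σ ⊎ Face (lk v L) (σ - w)
    to {σ} σ∈ with v∉σ , σv∈K ← Face-lk⁻ K σ∈ with proj₁ (faces G) σv∈K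
    ... | inj₁ σv∈M = contradiction (M-closed G (⁅⁆-⊆ (v∈σ∪⁅v⁆ σ)) σv∈M) v∉M
    ... | inj₂ σv-w∈L = inj₂ (Face-lk⁺ L (v∉σ ∘ p─q⊆p σ _) (closed L
      (∪⁅⁆-⊆ (λ x∈ → let x∈σ , x≢w = x∈σ-v⁻ σ x∈ in x∈p∧x≢y⇒x∈p-y (p⊆p∪q _ x∈σ) x≢w)
             (x∈p∧x≢y⇒x∈p-y (v∈σ∪⁅v⁆ σ) v≢w)) σv-w∈L))

    ⊆′ : (σ ∪ ⁅ v ⁆) - w ⊆ (σ - w) ∪ ⁅ v ⁆
    ⊆′ {σ} x∈ with x∈σv , x≢w ← x∈σ-v⁻ (σ ∪ ⁅ v ⁆) x∈ with x∈σ∪⁅v⁆⁻ σ x∈σv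
    ... | inj₁ x∈σ = p⊆p∪q _ (x∈p∧x≢y⇒x∈p-y x∈σ x≢w)
    ... | inj₂ refl = v∈σ∪⁅v⁆ (σ - w)

    from : Face (lk v L) (σ - w) → Face (lk v K) σ
    from {σ} σ∈ with v∉ , σ-w∪v∈L ← Face-lk⁻ L σ∈ =
      Face-lk⁺ K (λ v∈σ → v∉ (x∈p∧x≢y⇒x∈p-y v∈σ v≢w))
        (proj₂ (faces G) (inj₂ (closed L (⊆′ {σ}) σ-w∪v∈L)))

  glue-delete : v ≢ w → ¬ M ⁅ v ⁆ → Glue w M (delete v L) (delete v K)
  glue-delete {v} v≢w v∉M = record
    { M-closed = M-closed G
    ; w∉M = w∉M G
    ; w∉L = w∉L G ∘ proj₁
    ; faces = to , from
    }
    where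
    to : Face (delete v K) σ → M σ ⊎ Face (delete v L) (σ - w)
    to {σ} (σ∈K , v∉σ) with proj₁ (faces G) σ∈K
    ... | inj₁ σ∈M = inj₁ σ∈M
    ... | inj₂ σ-w∈L = inj₂ (σ-w∈L , v∉σ ∘ p─q⊆p σ _)

    from : M σ ⊎ Face (delete v L) (σ - w) → Face (delete v K) σ
    from (inj₁ σ∈M) = proj₂ (faces G) (inj₁ σ∈M) , λ v∈σ → v∉M (M-closed G (⁅⁆-⊆ v∈σ) σ∈M)
    from (inj₂ (σ-w∈L , v∉)) =
      proj₂ (faces G) (inj₂ σ-w∈L) , λ v∈σ → v∉ (x∈p∧x≢y⇒x∈p-y v∈σ v≢w)

  glue-apex : Face L ⊥ → Vertex K w
  glue-apex ⊥∈L = proj₂ (faces G) (inj₂ (closed L ⊆⊥ ⊥∈L))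
    where
    ⊆⊥ : ⁅ w ⁆ - w ⊆ ⊥
    ⊆⊥ x∈ with x∈w , x≢w ← x∈σ-v⁻ ⁅ w ⁆ x∈ = contradiction (x∈⁅y⁆⇒x≡y _ x∈w) x≢w

  -- `M` avoids `w`, so all faces through the apex come from the cone.
  glue-lk-apex : Face (lk w K) ≐ Face L
  glue-lk-apex = to , from
    where
    to : Face (lk w K) σ → Face L σ
    to {σ} σ∈ with w∉σ , σw∈K ← Face-lk⁻ K σ∈ with proj₁ (faces G) σw∈K
    ... | inj₁ σw∈M = contradiction (v∈σ∪⁅v⁆ σ) (w∉M G σw∈M)
    ... | inj₂ σ∈L = closed L (-⊇ w∉σ (p⊆p∪q _)) σ∈L

    from : Face L σ → Face (lk w K) σ
    from {σ} σ∈L =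
      Face-lk⁺ K (w∉L G σ∈L) (proj₂ (faces G) (inj₂ (closed L ([σ∪⁅v⁆]-v⊆σ σ) σ∈L)))

  -- Once the base lies in `M`, every face of the cone that avoids `w` is already a face of `M`.
  glue-delete-apex : (∀ {σ} → Face L σ → M σ) → Face (delete w K) ≐ M
  glue-delete-apex L⊆M = to , λ σ∈M → proj₂ (faces G) (inj₁ σ∈M) , w∉M G σ∈M
    where
    to : Face (delete w K) σ → M σ
    to {σ} (σ∈K , w∉σ) with proj₁ (faces G) σ∈K
    ... | inj₁ σ∈M = σ∈M
    ... | inj₂ σ-w∈L = M-closed G (-⊇ w∉σ ⊆-refl) (L⊆M σ-w∈L)

  glue-cone : (∀ {σ} → ¬ M σ) → Cone w L K
  glue-cone ¬M = record
    { M-closed = λ _ ()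
    ; w∉M = λ ()
    ; w∉L = w∉L G
    ; faces = (λ σ∈K → [ (λ σ∈M → contradiction σ∈M ¬M) , inj₂ ]′ (proj₁ (faces G) σ∈K))
            , λ { (inj₂ σ-w∈L) → proj₂ (faces G) (inj₂ σ-w∈L) }
    }

cone-simplex : Cone w L K → ((σ , _) : IsSimplex r L) →
               w ∉ σ × ∣ σ ∪ ⁅ w ⁆ ∣ ≡ suc r × Face K ≐ (_⊆ σ ∪ ⁅ w ⁆)
cone-simplex {w = w} {L} {K} G (σ , ∣σ∣ , to , from) =
  w∉σ , trans (∣σ∪⁅v⁆∣≡1+∣σ∣ w∉σ) (cong suc ∣σ∣) , to′ , from′
  where
  w∉σ : w ∉ σ
  w∉σ = w∉L G (from ⊆-refl)

  to′ : Face K τ → τ ⊆ σ ∪ ⁅ w ⁆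
  to′ {τ} τ∈K with proj₁ (faces G) τ∈K
  ... | inj₂ τ-w∈L = ∪⁅⁆-mono (to τ-w∈L) ∘ σ⊆[σ-v]∪⁅v⁆ τ w

  from′ : τ ⊆ σ ∪ ⁅ w ⁆ → Face K τ
  from′ {τ} τ⊆ = proj₂ (faces G) (inj₂ (from λ x∈ →
    let x∈τ , x≢w = x∈σ-v⁻ τ x∈ in
    [ (λ x∈σ → x∈σ) , (λ x≡w → contradiction x≡w x≢w) ]′ (x∈σ∪⁅v⁆⁻ σ (τ⊆ x∈τ))))

-- The base is shed inside the cone: the link and the deletion of a base vertex are again cones with
-- apex `w`, and a cone over a simplex is a simplex.
cone-VD : Cone w L K → VertexDecomposable r L → VertexDecomposable (suc r) K
cone-VD G (simplex _ s) = VD-simplex (_ , proj₂ (cone-simplex G s))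
cone-VD G (shed _ v v∈ D R) = VD-shed (glue-vertex G v∈)
  (cone-VD (glue-lk G (glue-≢ G v∈) λ ()) R)
  (cone-VD (glue-delete G (glue-≢ G v∈) λ ()) D)

-- Lists that enumerate vertex sets.

elements : Subset n → List (Fin n)
elements σ = filter (_∈? σ) (allFin _)

elements-enumerates : (σ : Subset n) → Enumerates (elements σ) (_∈ σ)
elements-enumerates σ = filter⁺ (_∈? σ) (allFin⁺ _)
  , λ v → mk⇔ (λ v∈ → proj₂ (∈-filter⁻ (_∈? σ) {xs = allFin _} v∈))
              (λ v∈σ → ∈-filter⁺ (_∈? σ) (∈-allFin v) v∈σ)

Enumerates-∷ : {P Q : Pred (Fin n) 0ℓ} → (∀ {u} → P u ⇔ (u ≡ v ⊎ Q u)) → ¬ Q v →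
               Enumerates vs Q → Enumerates (v ∷ vs) P
Enumerates-∷ P⇔ ¬Qv (unique , vs⇔Q) =
  All.tabulate (λ { u∈ refl → ¬Qv (Equivalence.to (vs⇔Q _) u∈) }) ∷ unique
  , λ u → mk⇔
      (λ { (here u≡v) → Equivalence.from P⇔ (inj₁ u≡v)
         ; (there u∈) → Equivalence.from P⇔ (inj₂ (Equivalence.to (vs⇔Q u) u∈)) })
      (λ Pu → [ here , (λ Qu → there (Equivalence.from (vs⇔Q u) Qu)) ]′ (Equivalence.to P⇔ Pu))

Enumerates-length : Enumerates vs (_∈ σ) → length vs ≡ ∣ σ ∣
Enumerates-length {n} {vs = []} {σ} (_ , vs⇔σ) =
  sym (trans (cong ∣_∣ (Empty-unique λ (v , v∈) → contradiction (Equivalence.from (vs⇔σ v) v∈) λ ()))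
             (∣⊥∣≡0 n))
Enumerates-length {n} {vs = v ∷ vs} {σ} (v# ∷ unique , vs⇔σ) =
  trans (cong suc (Enumerates-length {vs = vs} {σ - v} (unique , λ u → mk⇔ to (from u))))
        (sym (∣σ∣≡1+∣σ-v∣ (Equivalence.to (vs⇔σ v) (here refl))))
  where
  to : u ∈ₗ vs → u ∈ σ - v
  to u∈ = x∈p∧x≢y⇒x∈p-y (Equivalence.to (vs⇔σ _) (there u∈)) (≢-sym (All.lookup v# u∈))

  from : ∀ u → u ∈ σ - v → u ∈ₗ vs
  from u u∈ with u∈σ , u≢v ← x∈σ-v⁻ σ u∈ with Equivalence.from (vs⇔σ u) u∈σ
  ... | here u≡v = contradiction u≡v u≢v
  ... | there u∈vs = u∈vs

-- Shedding orders in inductive form.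

-- The list of a shedding order, consumed from its head. Vertex decomposability of the deletions is
-- not stored, because `Shed-VD` recovers it from the rest of the list.
data Shed {n} : ℕ → Complex n → List (Fin n) → Set₁ where
  done : IsSimplex r K → Enumerates vs (Vertex K) → Shed r K vs
  shed : Vertex K v → VertexDecomposable r (lk v K) → Shed (suc r) (delete v K) vs →
         Shed (suc r) K (v ∷ vs)

Shed-VD : Shed r K vs → VertexDecomposable r K
Shed-VD (done s _) = VD-simplex s
Shed-VD (shed v∈ R S) = VD-shed v∈ R (Shed-VD S)

Shed-enumerates : Shed r K vs → Enumerates vs (Vertex K)
Shed-enumerates (done _ E) = E
Shed-enumerates {K = K} (shed {v = v} v∈ _ S) =
  Enumerates-∷ (mk⇔ to [ (λ { refl → v∈ }) , proj₁ ]′) (λ (_ , v∉v) → v∉v (x∈⁅x⁆ v))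
    (Shed-enumerates S)
  where
  to : Vertex K u → u ≡ v ⊎ Vertex (delete v K) u
  to {u} u∈ with u Fin.≟ v
  ... | yes u≡v = inj₁ u≡v
  ... | no u≢v = inj₂ (u∈ , λ v∈u → u≢v (sym (x∈⁅y⁆⇒x≡y u v∈u)))

simplex-vertices : Enumerates vs (_∈ σ) → Face K ≐ (_⊆ σ) → Enumerates vs (Vertex K)
simplex-vertices (unique , vs⇔σ) (to , from) = unique
  , λ v → mk⇔ (λ v∈ → from (⁅⁆-⊆ (Equivalence.to (vs⇔σ v) v∈)))
              (λ v∈K → Equivalence.from (vs⇔σ v) (to v∈K (x∈⁅x⁆ v)))

-- The apex stays to the end as a vertex of the final simplex, whose vertices may be listed in any
-- order; this puts `w` after all other vertices of its block.
cone-Shed : Cone w L K → VertexDecomposable r L → ∃[ vs ] Shed (suc r) K (vs ++ w ∷ [])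
cone-Shed {w = w} {K = K} G (simplex _ s@(σ , _)) with w∉σ , card , eq ← cone-simplex G s =
  elements σ , done (_ , card , eq) (simplex-vertices {K = K} enum eq)
  where
  σ-enum : Enumerates (elements σ) (_∈ σ)
  σ-enum = elements-enumerates σ

  enum : Enumerates (elements σ ++ w ∷ []) (_∈ σ ∪ ⁅ w ⁆)
  enum = ++⁺ (proj₁ σ-enum) ([] ∷ [])
      (λ { (w∈ , here refl) → w∉σ (Equivalence.to (proj₂ σ-enum _) w∈) })
    , λ v → mk⇔
        (λ v∈ → [ (λ v∈σ → p⊆p∪q _ (Equivalence.to (proj₂ σ-enum v) v∈σ))
                , (λ { (here refl) → v∈σ∪⁅v⁆ σ }) ]′ (∈-++⁻ (elements σ) v∈))
        (λ v∈ → [ (λ v∈σ → ∈-++⁺ˡ (Equivalence.from (proj₂ σ-enum v) v∈σ))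
                , (λ { refl → ∈-++⁺ʳ (elements σ) (here refl) }) ]′ (x∈σ∪⁅v⁆⁻ σ v∈))
cone-Shed G (shed _ v v∈ D R)
  with vs , S ← cone-Shed (glue-delete G (glue-≢ G v∈) λ ()) D =
  v ∷ vs , shed (glue-vertex G v∈) (cone-VD (glue-lk G (glue-≢ G v∈) λ ()) R) S

simplex-length : (K : Complex n) → IsSimplex r K → Enumerates vs (Vertex K) → length vs ≡ r
simplex-length {vs = vs} K (σ , ∣σ∣ , to , from) (unique , vs⇔K) =
  trans (Enumerates-length {vs = vs} {σ} (unique , λ v → mk⇔
    (λ v∈ → to (Equivalence.to (vs⇔K v) v∈) (x∈⁅x⁆ v))
    (λ v∈σ → Equivalence.from (vs⇔K v) (from (⁅⁆-⊆ v∈σ))))) ∣σ∣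

Shed-length : Shed r K vs → r ≤ length vs
Shed-length {K = K} (done s E) = ≤-reflexive (sym (simplex-length K s E))
Shed-length (shed _ _ S) = ≤-trans (Shed-length S) (n≤1+n _)

-- Each shed vertex lowers the number of those still to be shed by exactly one. Subtraction is
-- truncated, so the bound of `Shed-length` is what makes this true.
length∸ : Shed (suc r) K vs → length vs ∸ r ≡ suc (length vs ∸ suc r)
length∸ S = +-∸-assoc 1 (Shed-length S)

Shed⇒IsSheddingOrder : Shed r K vs → IsSheddingOrder r K vs
Shed⇒IsSheddingOrder S = record
  { pure = Ranked⇒PureOfRank (VD-ranked (Shed-VD S))
  ; enumerates = Shed-enumerates S
  ; links = links S
  ; deletions = deletions S
  ; remainder = remainder S
  }
  where
  done-length : (K : Complex n) → IsSimplex r K → Enumerates vs (Vertex K) → length vs ∸ r ≡ 0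
  done-length {r = r} K s E = trans (cong (_∸ r) (simplex-length K s E)) (n∸n≡0 r)

  links : Shed r K vs → (i : Fin (length vs)) → toℕ i < length vs ∸ r →
          VertexDecomposable (pred r) (lk (lookup vs i) (deleteFirst (toℕ i) vs K))
  links {K = K} (done s E) i i< rewrite done-length K s E = contradiction i< λ ()
  links (shed _ R _) zero _ = R
  links (shed _ _ S) (suc i) i< rewrite length∸ S with s≤s i<′ ← i< = links S i i<′

  deletions : Shed r K vs → (i : Fin (length vs)) → toℕ i < length vs ∸ r →
              VertexDecomposable r (deleteFirst (suc (toℕ i)) vs K)
  deletions {K = K} (done s E) i i< rewrite done-length K s E = contradiction i< λ ()
  deletions (shed _ _ S) zero _ = Shed-VD S
  deletions (shed _ _ S) (suc i) i< rewrite length∸ S with s≤s i<′ ← i< = deletions S i i<′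

  remainder : Shed r K vs → IsSimplex r (deleteFirst (length vs ∸ r) vs K)
  remainder {K = K} (done s E) rewrite done-length K s E = s
  remainder (shed _ _ S) rewrite length∸ S = remainder S

-- Initial pieces of sheddings.

-- Nothing is asked of the complex that remains, so pieces can be concatenated and moved from a link
-- to the whole complex.
data ShedSeq {n} : ℕ → Complex n → List (Fin n) → Set₁ where
  []  : ShedSeq r K []
  _∷_ : Vertex K v × VertexDecomposable r (lk v K) → ShedSeq (suc r) (delete v K) vs →
        ShedSeq (suc r) K (v ∷ vs)

deleteAll : List (Fin n) → Complex n → Complex n
deleteAll vs K = foldl (flip delete) K vs

deleteAll⊆ : ∀ us (K : Complex n) → Face (deleteAll us K) σ → Face K σ
deleteAll⊆ [] K σ∈ = σ∈
deleteAll⊆ (u ∷ us) K σ∈ = proj₁ (deleteAll⊆ us (delete u K) σ∈)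

ShedSeq-Shed : ShedSeq r K us → Shed r (deleteAll us K) vs → Shed r K (us ++ vs)
ShedSeq-Shed [] S = S
ShedSeq-Shed ((v∈ , R) ∷ us) S = shed v∈ R (ShedSeq-Shed us S)

ShedSeq-++ : ShedSeq r K us → ShedSeq r (deleteAll us K) vs → ShedSeq r K (us ++ vs)
ShedSeq-++ [] vs = vs
ShedSeq-++ (u ∷ us) vs = u ∷ ShedSeq-++ us vs

-- Vertices of L outside M can be shed from K in the order in which they are shed from L:
-- the links in K are cones over the links in L.
glue-ShedSeq : {M : Pred (Subset n) 0ℓ} → Glue w M L K → ShedSeq r L us →
               (∀ {σ} → M σ → Face L σ → Face (deleteAll us L) σ) →
               ShedSeq (suc r) K us × Glue w M (deleteAll us L) (deleteAll us K)
glue-ShedSeq G [] _ = [] , G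
glue-ShedSeq {L = L} {M = M} G (_∷_ {v = v} {vs = us} (v∈ , R) S) M∩L⊆ =
  let S′ , G′ = glue-ShedSeq (glue-delete G v≢w v∉M) S (λ σ∈M σ∈ → M∩L⊆ σ∈M (proj₁ σ∈)) in
  (glue-vertex G v∈ , cone-VD (glue-lk G v≢w v∉M) R) ∷ S′ , G′
  where
  v≢w = glue-≢ G v∈

  -- Common faces of `M` and `L` survive all the deletions, while `v` is itself deleted.
  v∉M : ¬ M ⁅ v ⁆
  v∉M v∈M = proj₂ (deleteAll⊆ us (delete v L) (M∩L⊆ v∈M v∈)) (x∈⁅x⁆ v)

-- What the induction on dimension yields for a link: a shedding that stops at a prescribed vertex
-- decomposable subcomplex.
Adapted : ℕ → Complex n → Pred (Subset n) 0ℓ → Set₁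
Adapted r K P = ∃[ us ] ShedSeq r K us × VertexDecomposable r (deleteAll us K)
                        × Face (deleteAll us K) ≐ P

stₛ-cong : (X : Complex n) {A B : Pred (Fin n) 0ℓ} → A ≐ B → stₛ A X ≐ stₛ B X
stₛ-cong X (to , from) = (λ (w , w∈ , σ∈) → w , to w∈ , σ∈) , (λ (w , w∈ , σ∈) → w , from w∈ , σ∈)

-- Shedding one star after another.

-- A star decomposition with `W` listed increasingly and the induction hypothesis already applied to
-- all links. The tail `ws` plays the part of the vertices after `w`.
data Chain {n} (k : ℕ) (X : Complex n) : List (Fin n) → Set₁ where
  end  : VertexDecomposable k (lk w X) → Chain k X (w ∷ [])
  cons : All (λ w′ → ¬ Face X (⁅ w ⁆ ∪ ⁅ w′ ⁆)) ws → Adapted k (lk w X) (O w (_∈ₗ ws) X) →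
         Chain k X ws → Chain k X (w ∷ ws)

-- No later vertex is adjacent to `w`, so the later stars avoid `w`; the star of `w` is the cone
-- over its link.
star-glue : All (λ w′ → ¬ Face X (⁅ w ⁆ ∪ ⁅ w′ ⁆)) ws → Face K ≐ stₛ (_∈ₗ (w ∷ ws)) X →
            Glue w (stₛ (_∈ₗ ws) X) (lk w X) K
star-glue {X = X} {w = w} {ws} {K} independent (K⊆ , ⊆K) = record
  { M-closed = λ σ⊆τ (w′ , w′∈ , τ∈ , τw′∈) →
      w′ , w′∈ , closed X σ⊆τ τ∈ , closed X (∪⁅⁆-mono σ⊆τ) τw′∈
  ; w∉M = λ {σ} (w′ , w′∈ , _ , σw′∈) w∈σ → All.lookup independent w′∈
      (closed X (∪⁅⁆-⊆ (⁅⁆-⊆ (p⊆p∪q _ w∈σ)) (v∈σ∪⁅v⁆ σ)) σw′∈)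
  ; w∉L = proj₁ ∘ Face-lk⁻ X
  ; faces = to , from
  }
  where
  to : Face K σ → stₛ (_∈ₗ ws) X σ ⊎ Face (lk w X) (σ - w)
  to {σ} σ∈K with K⊆ σ∈K
  ... | _ , here refl , _ , σw∈ =
    inj₂ (Face-lk⁺ X (v∉σ-v σ w) (closed X (∪⁅⁆-mono (p─q⊆p σ _)) σw∈))
  ... | w′ , there w′∈ , σ∈ , σw′∈ = inj₁ (w′ , w′∈ , σ∈ , σw′∈)

  from : stₛ (_∈ₗ ws) X σ ⊎ Face (lk w X) (σ - w) → Face K σ
  from (inj₁ (w′ , w′∈ , σ∈)) = ⊆K (w′ , there w′∈ , σ∈)
  from {σ} (inj₂ σ-w∈) with _ , σ-ww∈ ← Face-lk⁻ X σ-w∈ = ⊆K (w , here refl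
    , closed X (σ⊆[σ-v]∪⁅v⁆ σ w) σ-ww∈
    , closed X (∪⁅⁆-⊆ (σ⊆[σ-v]∪⁅v⁆ σ w) (v∈σ∪⁅v⁆ (σ - w))) σ-ww∈)

-- One block. The common faces of the link and the later stars form the overlap, so the link can be
-- shed down to it inside `K`. Then `w` has the overlap as its link, and its deletion leaves the
-- later stars.
peel : All (λ w′ → ¬ Face X (⁅ w ⁆ ∪ ⁅ w′ ⁆)) ws → (A : Adapted k (lk w X) (O w (_∈ₗ ws) X)) →
       (K : Complex n) → Face K ≐ stₛ (_∈ₗ (w ∷ ws)) X →
       let us , _ = A in
       ShedSeq (suc k) K us × Vertex (deleteAll us K) w
       × VertexDecomposable k (lk w (deleteAll us K))
       × Face (delete w (deleteAll us K)) ≐ stₛ (_∈ₗ ws) X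
peel {X = X} {w = w} independent (us , S , D , eq) K K≐ =
  let S′ , G = glue-ShedSeq (star-glue {K = K} independent K≐) S
                 (λ σ∈M σ∈L → proj₂ eq (σ∈L , σ∈M)) in
  S′ , glue-apex G (Ranked.⊥∈ (VD-ranked D))
  , VD-resp-≐ (deleteAll us (lk w X)) (lk w (deleteAll us K)) (≐-sym (glue-lk-apex G)) D
  , glue-delete-apex G (λ σ∈L → proj₂ (proj₁ eq σ∈L))

-- Keeps of the shedding only what the derived order needs: the place of each `w`, and the vertex
-- set of what is left when its block begins.
data Blocks {n} (X : Complex n) : List (Fin n) → List (Fin n) → Set where
  []    : Blocks X [] []
  block : ∀ us → (∀ v → v ∈ₗ us ++ w ∷ vs ⇔ stₛ (_∈ₗ (w ∷ ws)) X ⁅ v ⁆) →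
          Blocks X ws vs → Blocks X (w ∷ ws) (us ++ w ∷ vs)

Blocks-vertices : Blocks X ws vs → ∀ v → v ∈ₗ vs ⇔ stₛ (_∈ₗ ws) X ⁅ v ⁆
Blocks-vertices [] v = mk⇔ (λ ()) λ { (_ , () , _) }
Blocks-vertices (block us vertices _) = vertices

Shed-vertices : {P : Pred (Subset n) 0ℓ} → Shed r K vs → Face K ≐ P → ∀ v → v ∈ₗ vs ⇔ P ⁅ v ⁆
Shed-vertices S (to , from) v = let vs⇔K = proj₂ (Shed-enumerates S) v in
  mk⇔ (to ∘ Equivalence.to vs⇔K) (Equivalence.from vs⇔K ∘ from)

-- `K` is any complex with the right faces, because what the deletions leave agrees with a union of
-- stars only face by face.
Chain-Shed : Chain k X ws → (K : Complex n) → Face K ≐ stₛ (_∈ₗ ws) X →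
             ∃[ vs ] Shed (suc k) K vs × Blocks X ws vs
-- For the last vertex the later stars are void, and the glue reduces to a cone.
Chain-Shed {X = X} (end {w = w} D) K K≐
  with vs , S ← cone-Shed (glue-cone (star-glue {X = X} {w = w} {K = K} [] K≐) λ { (_ , () , _) }) D =
  vs ++ w ∷ [] , S , block vs (Shed-vertices S K≐) []
Chain-Shed (cons {w = w} independent A@(us , _) C) K K≐
  with S , w∈ , R , K′≐ ← peel independent A K K≐
  with vs , S′ , B ← Chain-Shed C (delete w (deleteAll us K)) K′≐ =
  let S″ = ShedSeq-Shed S (shed w∈ R S′) in
  us ++ w ∷ vs , S″ , block us (Shed-vertices S″ K≐) B

suffix : {v : Fin n} {ws : List (Fin n)} → v ∈ₗ ws → List (Fin n)
suffix {ws = ws} (here _) = ws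
suffix (there v∈) = suffix v∈

-- Stop just before the block of the chosen vertex: the remaining stars still form a chain, which
-- makes what is left vertex decomposable.
Chain-Adapted : Chain k X ws → (w∈ : w ∈ₗ ws) → (K : Complex n) → Face K ≐ stₛ (_∈ₗ ws) X →
                Adapted (suc k) K (stₛ (_∈ₗ suffix w∈) X)
Chain-Adapted C (here _) K K≐ = [] , [] , Shed-VD (proj₁ (proj₂ (Chain-Shed C K K≐))) , K≐
Chain-Adapted (cons {w = w} independent A@(us , _) C) (there w∈) K K≐
  with S , w∈K , R , K′≐ ← peel independent A K K≐
  with us′ , S′ , D , eq ← Chain-Adapted C w∈ (delete w (deleteAll us K)) K′≐ =
  us ++ w ∷ us′ , ShedSeq-++ S ((w∈K , R) ∷ S′)
  , subst (VertexDecomposable _) (sym (foldl-++ (flip delete) K us (w ∷ us′))) D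
  , subst (λ L → Face L ≐ _) (sym (foldl-++ (flip delete) K us (w ∷ us′))) eq

-- Listing `W` in increasing order.

module _ {_≺_ : Rel (Fin n) 0ℓ} (total : IsTotalOrderOn W _≺_) where

  open IsStrictTotalOrder total using (compare)

  ≺-irrefl : w ∈ W → ¬ w ≺ w
  ≺-irrefl w∈ = IsStrictTotalOrder.irrefl total {_ , w∈} {_ , w∈} refl

  ≺-asym : v ∈ W → w ∈ W → v ≺ w → ¬ w ≺ v
  ≺-asym v∈ w∈ = IsStrictTotalOrder.asym total {_ , v∈} {_ , w∈}

  ≺-trans : u ∈ W → v ∈ W → w ∈ W → u ≺ v → v ≺ w → u ≺ w
  ≺-trans u∈ v∈ w∈ = IsStrictTotalOrder.trans total {_ , u∈} {_ , v∈} {_ , w∈}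

  insert : w ∈ W → All (_∈ W) ws → AllPairs _≺_ ws →
           ∃[ ws′ ] AllPairs _≺_ ws′ × (∀ {v} → v ∈ₗ w ∷ ws ⇔ v ∈ₗ ws′)
  insert {w = w} w∈ [] [] = w ∷ [] , [] ∷ [] , mk⇔ (λ v∈ → v∈) (λ v∈ → v∈)
  insert {w = w} {ws = z ∷ zs} w∈ (z∈ ∷ zs∈) (z≺ ∷ sorted) with compare (w , w∈) (z , z∈)
  ... | tri< w≺z _ _ = w ∷ z ∷ zs
    , (w≺z ∷ All.zipWith (λ (z≺x , x∈) → ≺-trans w∈ z∈ x∈ w≺z z≺x) (z≺ , zs∈)) ∷ z≺ ∷ sorted
    , mk⇔ (λ v∈ → v∈) (λ v∈ → v∈)
  -- A repeated element is dropped, which keeps the list strictly increasing.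
  ... | tri≈ _ refl _ = z ∷ zs , z≺ ∷ sorted
    , mk⇔ (λ { (here refl) → here refl ; (there v∈) → v∈ }) there
  ... | tri> _ _ z≺w with zs′ , sorted′ , zs⇔ ← insert w∈ zs∈ sorted = z ∷ zs′
    , All.tabulate (λ x∈ → lower (Equivalence.from zs⇔ x∈)) ∷ sorted′
    , mk⇔ (λ { (here refl) → there (Equivalence.to zs⇔ (here refl))
             ; (there (here v≡z)) → here v≡z
             ; (there (there v∈)) → there (Equivalence.to zs⇔ (there v∈)) })
          (λ { (here v≡z) → there (here v≡z)
             ; (there v∈) → [ here , there ∘ there ]′ (split (Equivalence.from zs⇔ v∈)) })
    where
    lower : ∀ {x} → x ∈ₗ w ∷ zs → z ≺ x
    lower (here refl) = z≺w
    lower (there x∈) = All.lookup z≺ x∈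

    split : ∀ {x} → x ∈ₗ w ∷ zs → x ≡ w ⊎ x ∈ₗ zs
    split (here x≡w) = inj₁ x≡w
    split (there x∈) = inj₂ x∈

  sortBy : All (_∈ W) ws → ∃[ ws′ ] AllPairs _≺_ ws′ × (∀ {v} → v ∈ₗ ws ⇔ v ∈ₗ ws′)
  sortBy [] = [] , [] , mk⇔ (λ v∈ → v∈) (λ v∈ → v∈)
  sortBy (w∈ ∷ ws∈) with ws′ , sorted , ws⇔ ← sortBy ws∈
    with ws″ , sorted″ , ws″⇔ ← insert w∈ (All.tabulate λ v∈ →
           All.lookup ws∈ (Equivalence.from ws⇔ v∈)) sorted = ws″ , sorted″
    , mk⇔ (λ { (here refl) → Equivalence.to ws″⇔ (here refl)
             ; (there v∈) → Equivalence.to ws″⇔ (there (Equivalence.to ws⇔ v∈)) })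
          (λ v∈ → back (Equivalence.from ws″⇔ v∈))
    where
    back : v ∈ₗ _ ∷ ws′ → v ∈ₗ _ ∷ _
    back (here v≡w) = here v≡w
    back (there v∈) = there (Equivalence.from ws⇔ v∈)

  sorted-list : ∃[ ws ] AllPairs _≺_ ws × (_∈ W) ≐ (_∈ₗ ws)
  sorted-list with W⇔ ← proj₂ (elements-enumerates W)
    with ws , sorted , ws⇔ ← sortBy (All.tabulate λ {v} v∈ → Equivalence.to (W⇔ v) v∈) =
    ws , sorted , (λ v∈ → Equivalence.to ws⇔ (Equivalence.from (W⇔ _) v∈))
                , (λ v∈ → Equivalence.to (W⇔ _) (Equivalence.from ws⇔ v∈))

  -- Matches the tails at which `Chain-Adapted` stops with the sets allowed by the order condition.
  suffix≐⪰ : All (_∈ W) ws → AllPairs _≺_ ws → (w∈ : w ∈ₗ ws) →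
             (_∈ₗ suffix w∈) ≐ (λ v → v ∈ₗ ws × (w ≺ v ⊎ w ≡ v))
  suffix≐⪰ (z∈ ∷ _) (z≺ ∷ _) (here refl) =
    (λ { (here refl) → here refl , inj₂ refl ; (there v∈) → there v∈ , inj₁ (All.lookup z≺ v∈) })
    , proj₁
  suffix≐⪰ {ws = z ∷ _} {w = w} (z∈ ∷ zs∈) (z≺ ∷ sorted) (there w∈)
    with to , from ← suffix≐⪰ zs∈ sorted w∈ = (λ v∈ → let v∈zs , w⪯v = to v∈ in there v∈zs , w⪯v)
      , λ { (here refl , w⪯z) → contradiction w⪯z z⋡w ; (there v∈ , w⪯v) → from (v∈ , w⪯v) }
    where
    z⋡w : ¬ (w ≺ z ⊎ w ≡ z)
    z⋡w (inj₁ w≺z) = ≺-asym z∈ (All.lookup zs∈ w∈) (All.lookup z≺ w∈) w≺z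
    z⋡w (inj₂ refl) = ≺-irrefl z∈ (All.lookup z≺ w∈)

  -- `covers` is the invariant of the walk along the sorted list: whatever has been passed lies
  -- below all that remains.
  IsLast-last : w ∈ W → (∀ {v} → v ∈ W → v ∈ₗ w ∷ [] ⊎ All (v ≺_) (w ∷ [])) → IsLast (_∈ W) _≺_ w
  IsLast-last w∈ covers = w∈ , λ v∈ →
    [ (λ { (here v≡w) → inj₂ v≡w }) , (λ { (v≺w ∷ []) → inj₁ v≺w }) ]′ (covers v∈)

  ≻≐tail : All (_∈ W) (w ∷ ws) → All (w ≺_) ws →
           (∀ {v} → v ∈ W → v ∈ₗ w ∷ ws ⊎ All (v ≺_) (w ∷ ws)) → (_∈ₗ ws) ≐ (W ⟨ _≺_ ⟩≻ w)
  ≻≐tail {w = w} {ws} (w∈ ∷ ws∈) w≺ covers = (λ v∈ → All.lookup ws∈ v∈ , All.lookup w≺ v∈) , from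
    where
    from : (W ⟨ _≺_ ⟩≻ w) v → v ∈ₗ ws
    from (v∈ , w≺v) with covers v∈
    ... | inj₁ (here refl) = contradiction w≺v (≺-irrefl w∈)
    ... | inj₁ (there v∈ws) = v∈ws
    ... | inj₂ (v≺w ∷ _) = contradiction w≺v (≺-asym v∈ w∈ v≺w)

-- From star decompositions to chains.

IsSimplex-⊥ : (X : Complex n) → Face X ≐ ｛ ⊥ ｝ → IsSimplex 0 X
IsSimplex-⊥ {n} X (to , from) = ⊥ , ∣⊥∣≡0 n , (λ σ∈ → ⊆-reflexive (sym (to σ∈)))
  , λ σ⊆⊥ → from (⊆-antisym (⊆-min _) σ⊆⊥)

-- In dimension 0 a face of the link has no room for a vertex beside `w`. This serves the case in
-- which the link condition is void.
IsSimplex-lk : Vertex X w → (∀ σ → Face X σ → ∣ σ ∣ ≤ 1) → IsSimplex 0 (lk w X)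
IsSimplex-lk {n} {X} {w} w∈X bound = ⊥ , ∣⊥∣≡0 n , to
  , λ σ⊆⊥ → Face-lk⁺ X (∉⊥ ∘ σ⊆⊥) (closed X (∪⁅⁆-⊆ (⊆-min _ ∘ σ⊆⊥) (x∈⁅x⁆ w)) w∈X)
  where
  to : Face (lk w X) σ → σ ⊆ ⊥
  to {σ} σ∈ with w∉σ , σw∈ ← Face-lk⁻ X σ∈
    with s≤s ∣σ∣≤0 ← subst (_≤ 1) (∣σ∪⁅v⁆∣≡1+∣σ∣ w∉σ) (bound _ σw∈)
    with refl ← ∣σ∣≤0⇒σ≡⊥ {σ = σ} ∣σ∣≤0 = ⊆-refl

-- Mutual recursion on the explicit `k`: `SD-VD` and `SD-Adapted` run the chain from `SD-Chain`,
-- which calls them back on links, one dimension lower.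
SD-VD : ∀ k {X : Complex n} {S} → StarDecomposablePair k X S → VertexDecomposable k X

SD-Adapted : ∀ k {X : Complex n} {S} → StarDecomposablePair (suc k) X S →
             Adapted (suc k) X (stₛ (_∈ S) X)

SD-Chain : ∀ k {X : Complex n} {S W _≺_} → HasRank (suc k) X → InducesStarPartition X W →
           IsTotalOrderOn W _≺_ →
           StarDecompositionConditions k (StarDecomposablePair k) X S W _≺_ →
           ∃[ ws ] AllPairs _≺_ ws × (_∈ W) ≐ (_∈ₗ ws)
             × Face X ≐ stₛ (_∈ₗ ws) X × Chain k X ws

SD-VD zero {X} (base X≐⊥ _) = VD-simplex (IsSimplex-⊥ X X≐⊥)
SD-VD (suc k) {X} (step (_ , rank) partition total (step conditions))
  with _ , _ , _ , X≐ , C ← SD-Chain k rank partition total conditions =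
  Shed-VD (proj₁ (proj₂ (Chain-Shed C X X≐)))

SD-Adapted k {X} {S} (step {W = W} {_≺_} (_ , rank) partition total (step conditions))
  with ws , sorted , (W⊆ , ⊆W) , X≐ , C ← SD-Chain k rank partition total conditions
  with w , w∈ , S≐ ← StarDecompositionConditions.order conditions
  with us , sheds , D , eq ← Chain-Adapted C (W⊆ w∈) X X≐ =
  us , sheds , D , ≐-trans eq (stₛ-cong X (≐-trans (suffix≐⪰ total (All.tabulate ⊆W) sorted (W⊆ w∈))
    (≐-trans ((λ (v∈ , w⪯v) → ⊆W v∈ , w⪯v) , (λ (v∈ , w⪯v) → W⊆ v∈ , w⪯v)) (≐-sym S≐))))

-- The convention for the complex of the empty face has empty `W`, which `nonempty` excludes.
SD-Chain k rank (inj₁ (_ , refl)) total conditions =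
  contradiction (proj₂ (StarDecompositionConditions.nonempty conditions)) ∉⊥
SD-Chain {n} k {X} {S} {W} {_≺_} (_ , bound) (inj₂ (W⊆X , X≐ , independent)) total conditions
  with zs , sorted , W≐@(W⊆ , ⊆W) ← sorted-list total =
  zs , sorted , W≐ , ≐-trans X≐ (stₛ-cong X W≐)
  , chain zs (W⊆ (proj₂ nonempty)) sorted (All.tabulate ⊆W) (inj₁ ∘ W⊆)
  where
  open StarDecompositionConditions conditions

  adapted : ∀ k → (∀ σ → Face X σ → ∣ σ ∣ ≤ suc k) →
            (0 < k → ∃[ U ] Nonempty U × (∀ {u} → u ∈ U → Vertex (lk w X) u)
               × stₛ (_∈ U) (lk w X) ≐ O w (W ⟨ _≺_ ⟩≻ w) X × StarDecomposablePair k (lk w X) U) →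
            w ∈ W → v ∈ₗ ws → v ∈ W → (_∈ₗ ws) ≐ (W ⟨ _≺_ ⟩≻ w) →
            Adapted k (lk w X) (O w (_∈ₗ ws) X)
  -- Here the link and the overlap both consist of the empty face alone; the later vertex `v` is the
  -- witness that its star contains that face.
  adapted {v = v} zero bound _ w∈ v∈ws v∈ _ =
    let s@(_ , _ , to , _) = IsSimplex-lk {X = X} (W⊆X w∈) bound in
    [] , [] , VD-simplex s , (λ σ∈ → σ∈ , v , v∈ws , lk⊆ X σ∈
      , closed X (∪⁅⁆-⊆ (⊆-min _ ∘ to σ∈) (x∈⁅x⁆ v)) (W⊆X v∈)) , proj₁
  adapted (suc k) _ link _ _ _ ws≐
    with U , _ , _ , eq , D ← link (s≤s z≤n)
    with us , sheds , V , eq′ ← SD-Adapted k D =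
    us , sheds , V , ≐-trans eq′ (≐-trans eq
      ( (λ (σ∈ , σ∈st) → σ∈ , proj₂ (stₛ-cong X ws≐) σ∈st)
      , (λ (σ∈ , σ∈st) → σ∈ , proj₁ (stₛ-cong X ws≐) σ∈st)))

  -- Membership of `v` rules out the empty list, for which there is no chain.
  chain : ∀ ws → v ∈ₗ ws → AllPairs _≺_ ws → All (_∈ W) ws →
          (∀ {v} → v ∈ W → v ∈ₗ ws ⊎ All (v ≺_) ws) → Chain k X ws
  chain (w ∷ []) _ _ (w∈ ∷ _) covers = end (SD-VD k (proj₂ (last (IsLast-last total w∈ covers))))
  chain (w ∷ ws@(v ∷ _)) _ (w≺ ∷ sorted) (w∈ ∷ ws∈) covers = cons
    (All.zipWith (λ (x∈ , w≺x) → independent w∈ x∈ λ { refl → ≺-irrefl total w∈ w≺x }) (ws∈ , w≺))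
    (adapted k bound (λ 0<k → link 0<k w∈ not-last) w∈ (here refl) (All.head ws∈)
      (≻≐tail total (w∈ ∷ ws∈) w≺ covers))
    (chain ws (here refl) sorted ws∈ covers′)
    where
    not-last : ¬ IsLast (_∈ W) _≺_ w
    not-last (_ , greatest) with greatest (All.head ws∈)
    ... | inj₁ v≺w = ≺-asym total w∈ (All.head ws∈) (All.head w≺) v≺w
    ... | inj₂ refl = ≺-irrefl total w∈ (All.head w≺)

    covers′ : ∀ {v} → v ∈ W → v ∈ₗ ws ⊎ All (v ≺_) ws
    covers′ v∈ with covers v∈
    ... | inj₁ (here refl) = inj₂ w≺
    ... | inj₁ (there v∈ws) = inj₁ v∈ws
    ... | inj₂ (_ ∷ v≺ws) = inj₂ v≺ws

-- Comparison with the derived order.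

Precedes-∷ : {a b : Fin n} → Precedes vs a b → Precedes (u ∷ vs) a b
Precedes-∷ (i , j , i<j , eqᵢ , eqⱼ) = suc i , suc j , s≤s i<j , eqᵢ , eqⱼ

Precedes-++ : {a b : Fin n} → ∀ us → Precedes vs a b → Precedes (us ++ vs) a b
Precedes-++ [] p = p
Precedes-++ (_ ∷ us) p = Precedes-∷ (Precedes-++ us p)

∈-Precedes : {a b : Fin n} → a ∈ₗ us → b ∈ₗ vs → Precedes (us ++ vs) a b
∈-Precedes {us = u ∷ us} (here refl) b∈ = zero , suc (index b∈′) , s≤s z≤n , refl , sym (lookup-index b∈′)
  where b∈′ = ∈-++⁺ʳ us b∈
∈-Precedes (there a∈) b∈ = Precedes-∷ (∈-Precedes a∈ b∈)

module _ {X : Complex n} {_≺_ : Rel (Fin n) 0ℓ} (total : IsTotalOrderOn W _≺_) where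

  -- Later blocks list vertices in stars of later members of `W`, and `w` is the last member whose
  -- star contains `v`.
  ∉-later : w ∈ W → All (_∈ W) ws → All (w ≺_) ws → Blocks X ws vs → IsP X W _≺_ v w → ¬ v ∈ₗ vs
  ∉-later {v = v} w∈ ws∈ w≺ B (_ , greatest) v∈
    with w′ , w′∈ , v∈st ← Equivalence.to (Blocks-vertices B v) v∈
    with greatest (All.lookup ws∈ w′∈ , v∈st)
  ... | inj₁ w′≺w = ≺-asym total w∈ (All.lookup ws∈ w′∈) (All.lookup w≺ w′∈) w′≺w
  ... | inj₂ refl = ≺-irrefl total w∈ (All.lookup w≺ w′∈)

  -- By `∉-later`, `u` stands in the block of `a`; since `v` lies in the star of the later `b`, it
  -- is listed after that block.
  Blocks-Precedes : {a b : Fin n} → All (_∈ W) ws → AllPairs _≺_ ws → Blocks X ws vs →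
                    a ∈ₗ ws → b ∈ₗ ws → a ≺ b → IsP X W _≺_ u a → st b X ⁅ v ⁆ → Precedes vs u v
  Blocks-Precedes {u = u} {v} (z∈ ∷ ws∈) (z≺ ∷ sorted) (block us vertices B) (here refl) (there b∈) _ u-p v∈
    with ∈-++⁻ us (Equivalence.from (vertices u) (_ , here refl , proj₂ (proj₁ u-p)))
  ... | inj₁ u∈ = ∈-Precedes u∈ (there (Equivalence.from (Blocks-vertices B v) (_ , b∈ , v∈)))
  ... | inj₂ (here refl) = Precedes-++ us
    (∈-Precedes (here {xs = []} refl) (Equivalence.from (Blocks-vertices B v) (_ , b∈ , v∈)))
  ... | inj₂ (there u∈) = contradiction u∈ (∉-later z∈ ws∈ z≺ B u-p)
  Blocks-Precedes (z∈ ∷ _) _ _ (here refl) (here refl) a≺b = contradiction a≺b (≺-irrefl total z∈)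
  Blocks-Precedes (z∈ ∷ ws∈) (z≺ ∷ _) _ (there a∈) (here refl) a≺b =
    contradiction a≺b (≺-asym total z∈ (All.lookup ws∈ a∈) (All.lookup z≺ a∈))
  Blocks-Precedes (_ ∷ ws∈) (_ ∷ sorted) (block us _ B) (there a∈) (there b∈) a≺b u-p v∈ =
    Precedes-++ us (Precedes-∷ (Blocks-Precedes ws∈ sorted B a∈ b∈ a≺b u-p v∈))

  -- `v` stands in the block of `w`, and `w` closes that block.
  Blocks-Precedes-apex : All (_∈ W) ws → AllPairs _≺_ ws → Blocks X ws vs →
                         w ∈ₗ ws → IsP X W _≺_ v w → v ≢ w → Precedes vs v w
  Blocks-Precedes-apex {v = v} (z∈ ∷ ws∈) (z≺ ∷ _) (block us vertices B) (here refl) v-p v≢w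
    with ∈-++⁻ us (Equivalence.from (vertices v) (_ , here refl , proj₂ (proj₁ v-p)))
  ... | inj₁ v∈ = ∈-Precedes v∈ (here refl)
  ... | inj₂ (here v≡w) = contradiction v≡w v≢w
  ... | inj₂ (there v∈) = contradiction v∈ (∉-later z∈ ws∈ z≺ B v-p)
  Blocks-Precedes-apex (_ ∷ ws∈) (_ ∷ sorted) (block us _ B) (there w∈) v-p v≢w =
    Precedes-++ us (Precedes-∷ (Blocks-Precedes-apex ws∈ sorted B w∈ v-p v≢w))

theorem7 : ∀ {n} (r : ℕ) (X : Complex n) (W : Subset n) (_≺_ : Rel (Fin n) 0ℓ) →
    StarDecomposable r X →
    InducesStarPartition X W →
    IsTotalOrderOn W _≺_ →
    InducesStarDecomposition r X W _≺_ →
    ∃[ vs ] IsSheddingOrder r X vs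
      × (∀ v v′ → DerivedOrder X W _≺_ v v′ → Precedes vs v v′)
theorem7 zero X W _≺_ (_ , base X≐⊥@(to , _) _) _ _ (_ , base _ _ refl) =
  [] , Shed⇒IsSheddingOrder (done (IsSimplex-⊥ X X≐⊥) ([] , λ v → mk⇔ (λ ()) λ v∈ →
         contradiction (subst (v ∈_) (sym (to v∈)) (x∈⁅x⁆ v)) ∉⊥))
  , λ { v v′ (inj₁ (_ , _ , ((w∈ , _) , _) , _)) → contradiction w∈ ∉⊥
      ; v v′ (inj₂ (v′∈ , _)) → contradiction v′∈ ∉⊥ }
theorem7 (suc k) X W _≺_ (_ , step (_ , rank) _ _ _) partition total (_ , step conditions)
  -- The dimension comes from the star decomposability of `X`, the chain from the given `W` and
  -- `_≺_`.
  with ws , sorted , (W⊆ , ⊆W) , X≐ , C ← SD-Chain k rank partition total conditions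
  with vs , S , B ← Chain-Shed C X X≐ = vs , Shed⇒IsSheddingOrder S , precedes
  where
  precedes : ∀ v v′ → DerivedOrder X W _≺_ v v′ → Precedes vs v v′
  precedes v v′ (inj₁ (w , w′ , v-p@((w∈ , _) , _) , ((w′∈ , v′∈) , _) , w≺w′)) =
    Blocks-Precedes total (All.tabulate ⊆W) sorted B (W⊆ w∈) (W⊆ w′∈) w≺w′ v-p v′∈
  precedes v v′ (inj₂ (v′∈ , v-p , v≢v′)) =
    Blocks-Precedes-apex total (All.tabulate ⊆W) sorted B (W⊆ v′∈) v-p v≢v′
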